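{- For every integer $n\ge1$, $spt_o^{+}(2n)\equiv spt(n)\pmod 2$.
   Context: For a nonempty integer partition $\pi$, let $s(\pi)$ be its smallest part. $spt_o^{+}(m)$ is the total number of occurrences of the smallest part, summed over all partitions $\pi$ of $m$ in which no odd part is greater than $2s(\pi)$. $spt(n)$ is the total number of occurrences of the smallest part, summed over all partitions of $n$. -}

module Defs where

open import Data.Nat using (ℕ; zero; suc; _+_; _*_; _∸_; _≤ᵇ_)
open import Data.Bool using (Bool; true; false; if_then_else_; _∧_)
open import Data.List using (List; []; _∷_; map; concatMap; length; filter; upTo)
open import Data.Nat.ListAction using (sum)

-- A partition is a list of positive parts in non-increasing order.
-- bparts k n : all partitions of n whose parts are all ≤ k (each exactly once).
-- Fuel f ≥ n guarantees termination (each step removes a part ≥ 1).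
bpartsF : ℕ → ℕ → ℕ → List (List ℕ)
bpartsF fuel      k zero    = [] ∷ []
bpartsF zero      k (suc n) = []
bpartsF (suc fuel) k (suc n) =
  concatMap (λ p → if p ≤ᵇ suc n
                    then map (p ∷_) (bpartsF fuel p (suc n ∸ p))
                    else [])
            (Data.List.map suc (Data.List.upTo k))

partitions : ℕ → List (List ℕ)
partitions n = bpartsF n n n

-- smallest part (last part of a non-increasing list); 0 for the empty partition
smallest : List ℕ → ℕ
smallest []       = 0
smallest (x ∷ []) = x
smallest (x ∷ xs) = smallest xs

occSmallest : List ℕ → ℕ
occSmallest π = length (filter (λ x → x Data.Nat.≟ smallest π) π)

isOdd : ℕ → Bool
isOdd zero = false
isOdd (suc zero) = true
isOdd (suc (suc n)) = isOdd n

oddCondition : List ℕ → Bool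
oddCondition π = go π
  where
  go : List ℕ → Bool
  go [] = true
  go (x ∷ xs) = (if isOdd x then x ≤ᵇ 2 * smallest π else true) ∧ go xs

spt : ℕ → ℕ
spt n = sum (map occSmallest (partitions n))

sptoPlus : ℕ → ℕ
sptoPlus m = sum (map occSmallest (filter (λ π → Data.Bool._≟_ (oddCondition π) true) (partitions m)))

{-# OPTIONS --safe #-}
module Submission where

-- Modulo 2 everything is computed in 𝔽₂[[q]]. With x = q², let A_m^(r) (m ≥ 1) and B_m^(r) (m ≥ 0) be the
-- parts of the generating function of sptoPlus coming from the smallest part 2m and 2m + 1 respectively,
-- in which every odd part 2j + 1 is replaced by 2(j + r) + 1. For u = x^m and v = q^(2(m+r)+1), the identity
--   u/((1 - u)²(1 - v)) + v/((1 - v)²(1 - uv)) = u/((1 - u)²(1 - uv)) + v/((1 - v)²(1 - u))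
-- gives A_m^(r) + B_m^(r) = A_m^(r+1) + B_{m-1}^(r+1). Summing over m, the total H^(r) of all A_m^(r) and
-- B_m^(r) satisfies H^(r) - H^(r+1) = B_0^(r), and B_0^(r) = v/(1 - v²) ∏ 1/(1 - x^i) has only odd powers of q.
-- So the even coefficients of H^(r) do not depend on r; for large r the odd parts are too large to
-- matter, and only the partitions into even parts remain, which are counted by spt.

open import Defs
open import Data.Bool using (Bool; true; false; if_then_else_; not; _∧_; _xor_)
import Data.Bool.Properties as Bool
open import Data.Bool.ListAction using (all)
open import Data.Bool.Properties using (xor-same; xor-identityʳ; xor-comm; xor-assoc; ∧-distribˡ-xor; ∧-zeroʳ)
open import Data.Bool.Solver using (module xor-∧-Solver)
open import Data.List using (List; []; _∷_; _++_; _∷ʳ_; map; concatMap; length; filter; upTo)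
open import Data.List.Properties
  using (concatMap-cong; concatMap-map; concatMap-++; map-++; ++-identityʳ; upTo-∷ʳ;
         filter-accept; filter-all; filter-reject)
open import Data.List.Relation.Unary.All as All using (All; []; _∷_)
import Data.List.Relation.Unary.All.Properties as All
open import Data.Nat
open import Data.Nat.ListAction using (sum)
open import Data.Nat.Properties
open import Data.Product using (_×_; _,_)
open import Data.Unit using (⊤; tt)
open import Function using (_∘_; id)
open import Relation.Binary.PropositionalEquality
open import Relation.Nullary using (yes; no; contradiction)

open xor-∧-Solver using (solve; _:+_; _:*_; _:=_)

-- Doubling, and coefficient sequences over 𝔽₂.

dbl : ℕ → ℕ
dbl zero    = zero
dbl (suc n) = suc (suc (dbl n))

dbl-+ : ∀ m n → dbl (m + n) ≡ dbl m + dbl n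
dbl-+ zero    n = refl
dbl-+ (suc m) n = cong (suc ∘ suc) (dbl-+ m n)

dbl-mono-≤ : ∀ {m n} → m ≤ n → dbl m ≤ dbl n
dbl-mono-≤ z≤n       = z≤n
dbl-mono-≤ (s≤s m≤n) = s≤s (s≤s (dbl-mono-≤ m≤n))

dbl≡n+n : ∀ n → dbl n ≡ n + n
dbl≡n+n zero    = refl
dbl≡n+n (suc n) = cong suc (trans (cong suc (dbl≡n+n n)) (sym (+-suc n n)))

2*n≡dbl : ∀ n → 2 * n ≡ dbl n
2*n≡dbl n = trans (cong (n +_) (+-identityʳ n)) (sym (dbl≡n+n n))

-- Formal power series over 𝔽₂, as coefficient sequences.
Series : Set
Series = ℕ → Bool

infixl 6 _⊕_
_⊕_ : Series → Series → Series
(f ⊕ g) n = f n xor g n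

𝟘 δ : Series
𝟘 _ = false
δ zero    = true
δ (suc _) = false

shift : ℕ → Series → Series
shift zero    f n       = f n
shift (suc p) f zero    = false
shift (suc p) f (suc n) = shift p f n

shift-local : ∀ p {f g n} → (∀ {j} → j ≤ n → f j ≡ g j) → shift p f n ≡ shift p g n
shift-local zero            f≡g = f≡g ≤-refl
shift-local (suc p) {n = zero}  f≡g = refl
shift-local (suc p) {n = suc n} f≡g = shift-local p (λ j≤n → f≡g (m≤n⇒m≤1+n j≤n))

-- A positive shift reads only strictly smaller indices; this makes recursion through
-- `shift (suc p)` well founded.
shift-suc-local : ∀ p {f g n} → (∀ {j} → j < n → f j ≡ g j) → shift (suc p) f n ≡ shift (suc p) g n
shift-suc-local p {n = zero}  f≡g = refl
shift-suc-local p {n = suc n} f≡g = shift-local p (f≡g ∘ s≤s)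

shift-cong : ∀ p {f g} → f ≗ g → shift p f ≗ shift p g
shift-cong p f≗g n = shift-local p (λ {j} _ → f≗g j)

shift-𝟘 : ∀ p → shift p 𝟘 ≗ 𝟘
shift-𝟘 zero    n       = refl
shift-𝟘 (suc p) zero    = refl
shift-𝟘 (suc p) (suc n) = shift-𝟘 p n

shift-⊕ : ∀ p f g → shift p (f ⊕ g) ≗ shift p f ⊕ shift p g
shift-⊕ zero    f g n       = refl
shift-⊕ (suc p) f g zero    = refl
shift-⊕ (suc p) f g (suc n) = shift-⊕ p f g n

shift-shift : ∀ p q f → shift p (shift q f) ≗ shift (p + q) f
shift-shift zero    q f n       = refl
shift-shift (suc p) q f zero    = refl
shift-shift (suc p) q f (suc n) = shift-shift p q f n

shift-comm : ∀ p q f → shift p (shift q f) ≗ shift q (shift p f)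
shift-comm p q f n = trans (shift-shift p q f n)
  (trans (cong (λ k → shift k f n) (+-comm p q)) (sym (shift-shift q p f n)))

shift-< : ∀ {p n} f → n < p → shift p f n ≡ false
shift-< {suc p} {zero}  f n<p       = refl
shift-< {suc p} {suc n} f (s≤s n<p) = shift-< f n<p

shift-if : ∀ p f n → shift p f n ≡ (if p ≤ᵇ n then f (n ∸ p) else false)
shift-if zero          f n       = refl
shift-if (suc p)       f zero    = refl
shift-if (suc zero)    f (suc n) = refl
shift-if (suc (suc p)) f (suc n) = shift-if (suc p) f n

-- The factor 1/(1 - q^(p+1)).

-- Fuel replaces well-founded recursion: each unfolding lowers the index, so `suc n` units settle
-- coefficient `n`.
geoF : ℕ → ℕ → Series → Series
geoF zero       p f n = false
geoF (suc fuel) p f n = f n xor shift (suc p) (geoF fuel p f) n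

geoF-fuel : ∀ p f {n k l} → n < k → n < l → geoF k p f n ≡ geoF l p f n
geoF-fuel p f {n} {suc k} {suc l} (s≤s n≤k) (s≤s n≤l) = cong (f n xor_)
  (shift-suc-local p (λ j<n → geoF-fuel p f (<-≤-trans j<n n≤k) (<-≤-trans j<n n≤l)))

opaque
  -- geo p is multiplication by 1/(1 - q^(p+1)): it adjoins a part of size p + 1.
  geo : ℕ → Series → Series
  geo p f n = geoF (suc n) p f n

  geo-eq : ∀ p f → geo p f ≗ f ⊕ shift (suc p) (geo p f)
  geo-eq p f n = cong (f n xor_)
    (shift-suc-local p {n = n} (λ {j} j<n → geoF-fuel p f {j} j<n (n<1+n j)))

-- The equation computes each coefficient of `g` from smaller ones. Since `geo` is opaque, the
-- identities below follow by checking that one side solves the equation of the other.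
geo-unique : ∀ p f {g} → g ≗ f ⊕ shift (suc p) g → g ≗ geo p f
geo-unique p f {g} g-eq n = agree (suc n) (n<1+n n)
  where
  agree : ∀ k {j} → j < k → g j ≡ geo p f j
  agree (suc k) {j} (s≤s j≤k) = trans (g-eq j) (trans
    (cong (f j xor_) (shift-suc-local p (λ i<j → agree k (<-≤-trans i<j j≤k))))
    (sym (geo-eq p f j)))

geo-cong : ∀ p {f g} → f ≗ g → geo p f ≗ geo p g
geo-cong p {f} {g} f≗g = geo-unique p g
  (λ n → trans (geo-eq p f n) (cong (_xor _) (f≗g n)))

geo-𝟘 : ∀ p → geo p 𝟘 ≗ 𝟘
geo-𝟘 p n = sym (geo-unique p 𝟘 (λ k → sym (shift-𝟘 (suc p) k)) n)

geo-≤ : ∀ p f {n} → n ≤ p → geo p f n ≡ f n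
geo-≤ p f {n} n≤p = trans (geo-eq p f n)
  (trans (cong (f n xor_) (shift-< (geo p f) (s≤s n≤p))) (xor-identityʳ (f n)))

geo-⊕ : ∀ p f g → geo p (f ⊕ g) ≗ geo p f ⊕ geo p g
geo-⊕ p f g n = sym (geo-unique p (f ⊕ g) eq n)
  where
  eq : geo p f ⊕ geo p g ≗ (f ⊕ g) ⊕ shift (suc p) (geo p f ⊕ geo p g)
  eq k = begin
    geo p f k xor geo p g k
      ≡⟨ cong₂ _xor_ (geo-eq p f k) (geo-eq p g k) ⟩
    (f k xor shift (suc p) (geo p f) k) xor (g k xor shift (suc p) (geo p g) k)
      ≡⟨ solve 4 (λ a b c d → (a :+ b) :+ (c :+ d) := (a :+ c) :+ (b :+ d)) refl
           (f k) (shift (suc p) (geo p f) k) (g k) (shift (suc p) (geo p g) k) ⟩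
    (f k xor g k) xor (shift (suc p) (geo p f) k xor shift (suc p) (geo p g) k)
      ≡⟨ cong ((f k xor g k) xor_) (shift-⊕ (suc p) (geo p f) (geo p g) k) ⟨
    (f k xor g k) xor shift (suc p) (geo p f ⊕ geo p g) k ∎
    where open ≡-Reasoning

geo-shift : ∀ p q f → geo p (shift q f) ≗ shift q (geo p f)
geo-shift p q f n = sym (geo-unique p (shift q f) eq n)
  where
  eq : shift q (geo p f) ≗ shift q f ⊕ shift (suc p) (shift q (geo p f))
  eq k = begin
    shift q (geo p f) k                               ≡⟨ shift-cong q (geo-eq p f) k ⟩
    shift q (f ⊕ shift (suc p) (geo p f)) k           ≡⟨ shift-⊕ q f (shift (suc p) (geo p f)) k ⟩
    (shift q f ⊕ shift q (shift (suc p) (geo p f))) k ≡⟨ cong (shift q f k xor_) (shift-comm q (suc p) (geo p f) k) ⟩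
    (shift q f ⊕ shift (suc p) (shift q (geo p f))) k ∎
    where open ≡-Reasoning

geo-comm : ∀ p q f → geo p (geo q f) ≗ geo q (geo p f)
geo-comm p q f n = sym (geo-unique p (geo q f) eq n)
  where
  eq : geo q (geo p f) ≗ geo q f ⊕ shift (suc p) (geo q (geo p f))
  eq k = begin
    geo q (geo p f) k                               ≡⟨ geo-cong q (geo-eq p f) k ⟩
    geo q (f ⊕ shift (suc p) (geo p f)) k           ≡⟨ geo-⊕ q f (shift (suc p) (geo p f)) k ⟩
    (geo q f ⊕ geo q (shift (suc p) (geo p f))) k   ≡⟨ cong (geo q f k xor_) (geo-shift q (suc p) (geo p f) k) ⟩
    (geo q f ⊕ shift (suc p) (geo q (geo p f))) k   ∎
    where open ≡-Reasoning

-- Over 𝔽₂, (1 - u)² = 1 - u².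
geo-geo : ∀ p f → geo p (geo p f) ≗ geo (p + suc p) f
geo-geo p f = geo-unique (p + suc p) f eq
  where
  g = geo p (geo p f)
  eq : g ≗ f ⊕ shift (suc p + suc p) g
  eq k = begin
    g k                                       ≡⟨ geo-eq p (geo p f) k ⟩
    geo p f k xor x                           ≡⟨ cong (_xor x) (geo-eq p f k) ⟩
    (f k xor shift (suc p) (geo p f) k) xor x
      ≡⟨ cong (λ b → (f k xor b) xor x) (trans (shift-cong (suc p) unfold k) (shift-⊕ (suc p) g (shift (suc p) g) k)) ⟩
    (f k xor (x xor y)) xor x
      ≡⟨ solve 3 (λ a b c → (a :+ (b :+ c)) :+ b := a :+ c) refl (f k) x y ⟩
    f k xor y                                 ≡⟨ cong (f k xor_) (shift-shift (suc p) (suc p) g k) ⟩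
    f k xor shift (suc p + suc p) g k         ∎
    where
    open ≡-Reasoning
    x = shift (suc p) g k
    y = shift (suc p) (shift (suc p) g) k
    unfold : geo p f ≗ g ⊕ shift (suc p) g
    unfold j = trans
      (solve 2 (λ a b → a := (a :+ b) :+ b) refl (geo p f j) (shift (suc p) g j))
      (cong (_xor shift (suc p) g j) (sym (geo-eq p (geo p f) j)))

-- Products of geometric factors, and weighting by multiplicity.

-- Adjoins the parts `h i + 1` for a ≤ i < a + d: the odd parts 2i + 1 for `h = dbl`, the even parts
-- 2i + 2 for `h = suc ∘ dbl`, and all parts i + 1 for `h = id`.
geos : (ℕ → ℕ) → ℕ → ℕ → Series → Series
geos h a zero    f = f
geos h a (suc d) f = geo (h a) (geos h (suc a) d f)

geos-cong : ∀ h a d {f g} → f ≗ g → geos h a d f ≗ geos h a d g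
geos-cong h a zero    f≗g = f≗g
geos-cong h a (suc d) f≗g = geo-cong (h a) (geos-cong h (suc a) d f≗g)

geo-geos : ∀ p h a d f → geo p (geos h a d f) ≗ geos h a d (geo p f)
geo-geos p h a zero    f n = refl
geo-geos p h a (suc d) f n = trans (geo-comm p (h a) (geos h (suc a) d f) n)
  (geo-cong (h a) (geo-geos p h (suc a) d f) n)

shift-geos : ∀ p h a d f → shift p (geos h a d f) ≗ geos h a d (shift p f)
shift-geos p h a zero    f n = refl
shift-geos p h a (suc d) f n = trans (sym (geo-shift (h a) p (geos h (suc a) d f) n))
  (geo-cong (h a) (shift-geos p h (suc a) d f) n)

-- The definition peels off the factor of lowest index; raising a bound on the largest part adds the
-- one of highest index.
geos-top : ∀ h a d f → geos h a (suc d) f ≗ geo (h (d + a)) (geos h a d f)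
geos-top h a zero    f n = refl
geos-top h a (suc d) f n = begin
  geo (h a) (geos h (suc a) (suc d) f) n                ≡⟨ geo-cong (h a) (geos-top h (suc a) d f) n ⟩
  geo (h a) (geo (h (d + suc a)) (geos h (suc a) d f)) n ≡⟨ geo-comm (h a) (h (d + suc a)) (geos h (suc a) d f) n ⟩
  geo (h (d + suc a)) (geos h a (suc d) f) n            ≡⟨ cong (λ i → geo (h i) (geos h a (suc d) f) n) (+-suc d a) ⟩
  geo (h (suc d + a)) (geos h a (suc d) f) n            ∎
  where open ≡-Reasoning

geos-≤ : ∀ h a d f {n} → (∀ i → a ≤ i → n ≤ h i) → geos h a d f n ≡ f n
geos-≤ h a zero    f n≤h = refl
geos-≤ h a (suc d) f n≤h = trans (geo-≤ (h a) (geos h (suc a) d f) (n≤h a ≤-refl))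
  (geos-≤ h (suc a) d f (λ i 1+a≤i → n≤h i (≤-trans (n≤1+n a) 1+a≤i)))

-- u/(1 - u)² for u = q^(p+1): adjoins a positive number of parts p + 1, weighted by that number
mark : ℕ → Series → Series
mark p f = shift (suc p) (geo p (geo p f))

mark-cong : ∀ p {f g} → f ≗ g → mark p f ≗ mark p g
mark-cong p f≗g = shift-cong (suc p) (geo-cong p (geo-cong p f≗g))

mark-geos : ∀ p h a d f → mark p (geos h a d f) ≗ geos h a d (mark p f)
mark-geos p h a d f n = begin
  shift (suc p) (geo p (geo p (geos h a d f))) n   ≡⟨ shift-cong (suc p) (geo-cong p (geo-geos p h a d f)) n ⟩
  shift (suc p) (geo p (geos h a d (geo p f))) n   ≡⟨ shift-cong (suc p) (geo-geos p h a d (geo p f)) n ⟩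
  shift (suc p) (geos h a d (geo p (geo p f))) n   ≡⟨ shift-geos (suc p) h a d (geo p (geo p f)) n ⟩
  geos h a d (mark p f) n                          ∎
  where open ≡-Reasoning

mark-≤ : ∀ p f {n} → n ≤ p → mark p f n ≡ false
mark-≤ p f n≤p = shift-< (geo p (geo p f)) (s≤s n≤p)

-- Coefficients of even and of odd index.

half : Series → Series
half f n = f (dbl n)

half-shift : ∀ p f → half (shift (dbl p) f) ≗ shift p (half f)
half-shift zero    f n       = refl
half-shift (suc p) f zero    = refl
half-shift (suc p) f (suc n) = half-shift p f n

half-geo : ∀ p f → half (geo (suc (dbl p)) f) ≗ geo p (half f)
half-geo p f = geo-unique p (half f) (λ n → trans (geo-eq (suc (dbl p)) f (dbl n))
  (cong (f (dbl n) xor_) (half-shift (suc p) (geo (suc (dbl p)) f) n)))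

half-mark : ∀ p f → half (mark (suc (dbl p)) f) ≗ mark p (half f)
half-mark p f n = trans (half-shift (suc p) (geo e (geo e f)) n)
  (shift-cong (suc p) (λ k → trans (half-geo p (geo e f) k) (geo-cong p (half-geo p f) k)) n)
  where e = suc (dbl p)

half-geos : ∀ a d f → half (geos (suc ∘ dbl) a d f) ≗ geos id a d (half f)
half-geos a zero    f n = refl
half-geos a (suc d) f n = trans (half-geo a (geos (suc ∘ dbl) (suc a) d f) n)
  (geo-cong a (half-geos (suc a) d f) n)

half-δ : half δ ≗ δ
half-δ zero    = refl
half-δ (suc n) = refl

half-shift-odd : ∀ p f → half (f ∘ suc) ≗ 𝟘 → half (shift (suc (dbl p)) f) ≗ 𝟘
half-shift-odd p       f f-odd zero    = refl
half-shift-odd zero    f f-odd (suc n) = f-odd n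
half-shift-odd (suc p) f f-odd (suc n) = half-shift-odd p f f-odd n

half-shift-suc : ∀ p f → half (shift (dbl p) f ∘ suc) ≗ shift p (half (f ∘ suc))
half-shift-suc zero    f n       = refl
half-shift-suc (suc p) f zero    = refl
half-shift-suc (suc p) f (suc n) = half-shift-suc p f n

-- `half (f ∘ suc)` lists the coefficients of odd index.
EvenSupport : Series → Set
EvenSupport f = half (f ∘ suc) ≗ 𝟘

geo-evenSupport : ∀ p {f} → EvenSupport f → EvenSupport (geo (suc (dbl p)) f)
geo-evenSupport p {f} f-even n = trans
  (geo-unique p 𝟘 (λ k → trans (geo-eq (suc (dbl p)) f (suc (dbl k)))
    (cong₂ _xor_ (f-even k) (half-shift-suc (suc p) (geo (suc (dbl p)) f) k))) n)
  (geo-𝟘 p n)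

geos-evenSupport : ∀ a d {f} → EvenSupport f → EvenSupport (geos (suc ∘ dbl) a d f)
geos-evenSupport a zero    f-even = f-even
geos-evenSupport a (suc d) {f} f-even =
  geo-evenSupport a {geos (suc ∘ dbl) (suc a) d f} (geos-evenSupport (suc a) d {f} f-even)

-- The exchange identity.

-- With u = q^(a+1) and v = q^(b+1): 1/(1 - v) - 1/(1 - uv) = v(1 - u)/((1 - v)(1 - uv)).
geo-difference : ∀ a b f →
  geo b (geo a f) ⊕ geo (a + suc b) (geo a f) ≗ shift (suc b) (geo b (geo (a + suc b) f))
geo-difference a b f n = begin
  geo b h n xor geo ab h n
    ≡⟨ cong₂ _xor_ (trans (geo-cong b (unfold ab h) n) (trans (geo-⊕ b (geo ab h) (shift (suc ab) (geo ab h)) n)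
                     (cong (geo b (geo ab h) n xor_) (geo-shift b (suc ab) (geo ab h) n))))
                   (unfold b (geo ab h) n) ⟩
  (Y n xor shift (suc a + suc b) Y n) xor (Y n xor shift (suc b) Y n)
    ≡⟨ solve 3 (λ y s t → (y :+ s) :+ (y :+ t) := t :+ s) refl (Y n) (shift (suc a + suc b) Y n) (shift (suc b) Y n) ⟩
  shift (suc b) Y n xor shift (suc a + suc b) Y n
    ≡⟨ cong (shift (suc b) Y n xor_) (trans (sym (shift-shift (suc a) (suc b) Y n)) (shift-comm (suc a) (suc b) Y n)) ⟩
  shift (suc b) Y n xor shift (suc b) (shift (suc a) Y) n
    ≡⟨ shift-⊕ (suc b) Y (shift (suc a) Y) n ⟨
  shift (suc b) (Y ⊕ shift (suc a) Y) n
    ≡⟨ shift-cong (suc b) (λ k → sym (trans (unfold a Z k) (cong₂ _xor_ (Y≗ k) (shift-cong (suc a) Y≗ k)))) n ⟩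
  shift (suc b) Z n ∎
  where
  open ≡-Reasoning
  ab = a + suc b
  h = geo a f
  Y = geo b (geo ab h)
  Z = geo b (geo ab f)
  unfold : ∀ p g → g ≗ geo p g ⊕ shift (suc p) (geo p g)
  unfold p g k = trans
    (solve 2 (λ x y → x := (x :+ y) :+ y) refl (g k) (shift (suc p) (geo p g) k))
    (cong (_xor shift (suc p) (geo p g) k) (sym (geo-eq p g k)))
  Y≗ : geo a Z ≗ Y
  Y≗ k = trans (geo-comm a b (geo ab f) k) (geo-cong b (geo-comm a ab f) k)

-- u/((1 - u)²(1 - v)) - u/((1 - u)²(1 - uv)) is symmetric in u and v by geo-difference.
exchange : ∀ a b f →
  mark a (geo b f) ⊕ mark b (geo (a + suc b) f) ≗ mark a (geo (a + suc b) f) ⊕ mark b (geo a f)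
exchange a b f n = begin
  A xor B
    -- `A′` and `B′` are each added twice, which changes nothing in characteristic 2.
    ≡⟨ solve 4 (λ x y z w → x :+ y := (((x :+ z) :+ (w :+ y)) :+ z) :+ w) refl A B A′ B′ ⟩
  (((A xor A′) xor (B′ xor B)) xor A′) xor B′
    ≡⟨ cong (λ z → (z xor A′) xor B′) (trans (cong₂ _xor_ (difference a b refl) B′-B) (xor-same C)) ⟩
  A′ xor B′ ∎
  where
  open ≡-Reasoning
  ab = a + suc b
  A  = mark a (geo b f) n
  B  = mark b (geo ab f) n
  A′ = mark a (geo ab f) n
  B′ = mark b (geo a f) n
  C  = shift (suc a) (shift (suc b) (geo a (geo b (geo ab f)))) n
  -- Keeping `p + suc r ≡ ab` as a hypothesis lets one statement serve both (a, b) and (b, a).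
  difference : ∀ p r → p + suc r ≡ ab →
    mark p (geo r f) n xor mark p (geo ab f) n
    ≡ shift (suc p) (shift (suc r) (geo p (geo r (geo ab f)))) n
  difference p r eq = begin
    mark p (geo r f) n xor mark p (geo ab f) n
      ≡⟨ shift-⊕ (suc p) _ _ n ⟨
    shift (suc p) (geo p (geo p (geo r f)) ⊕ geo p (geo p (geo ab f))) n
      ≡⟨ shift-cong (suc p) (λ k → sym (geo-⊕ p _ _ k)) n ⟩
    shift (suc p) (geo p (geo p (geo r f) ⊕ geo p (geo ab f))) n
      ≡⟨ shift-cong (suc p) (geo-cong p (λ k → trans
           (cong₂ _xor_ (geo-comm p r f k) (geo-comm p ab f k))
           (subst (λ c → (geo r (geo p f) ⊕ geo c (geo p f)) k ≡ shift (suc r) (geo r (geo c f)) k)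
             eq (geo-difference p r f k)))) n ⟩
    shift (suc p) (geo p (shift (suc r) (geo r (geo ab f)))) n
      ≡⟨ shift-cong (suc p) (geo-shift p (suc r) _) n ⟩
    shift (suc p) (shift (suc r) (geo p (geo r (geo ab f)))) n ∎
  B′-B : B′ xor B ≡ C
  B′-B = begin
    B′ xor B
      ≡⟨ difference b a (trans (+-comm b (suc a)) (sym (+-suc a b))) ⟩
    shift (suc b) (shift (suc a) (geo b (geo a (geo ab f)))) n
      ≡⟨ shift-comm (suc b) (suc a) _ n ⟩
    shift (suc a) (shift (suc b) (geo b (geo a (geo ab f)))) n
      ≡⟨ shift-cong (suc a) (shift-cong (suc b) (geo-comm b a _)) n ⟩
    C ∎

-- Finite sums over 𝔽₂.

⨁ : ℕ → (ℕ → Bool) → Bool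
⨁ zero    f = false
⨁ (suc n) f = ⨁ n f xor f n

⨁-cong : ∀ n {f g} → (∀ {i} → i < n → f i ≡ g i) → ⨁ n f ≡ ⨁ n g
⨁-cong zero    f≡g = refl
⨁-cong (suc n) f≡g = cong₂ _xor_ (⨁-cong n (f≡g ∘ m<n⇒m<1+n)) (f≡g (n<1+n n))

⨁-dbl : ∀ n f → ⨁ (dbl n) f ≡ ⨁ n (λ m → f (dbl m) xor f (suc (dbl m)))
⨁-dbl zero    f = refl
⨁-dbl (suc n) f = trans
  (solve 3 (λ x y z → (x :+ y) :+ z := x :+ (y :+ z)) refl (⨁ (dbl n) f) (f (dbl n)) (f (suc (dbl n))))
  (cong (_xor (f (dbl n) xor f (suc (dbl n)))) (⨁-dbl n f))

⨁-telescope : ∀ n (f g h : ℕ → Bool) →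
  (∀ {m} → m < n → f m ≡ (g m xor g (suc m)) xor h m) → ⨁ n f ≡ (g 0 xor g n) xor ⨁ n h
⨁-telescope zero    f g h f≡ = sym (trans (xor-identityʳ _) (xor-same (g 0)))
⨁-telescope (suc n) f g h f≡ = trans
  (cong₂ _xor_ (⨁-telescope n f g h (f≡ ∘ m<n⇒m<1+n)) (f≡ (n<1+n n)))
  (solve 5 (λ x y z s t → ((x :+ y) :+ s) :+ ((y :+ z) :+ t) := (x :+ z) :+ (s :+ t)) refl
    (g 0) (g n) (g (suc n)) (⨁ n h) (h n))

-- Series for a fixed smallest part, and raising the odd parts by two.

evens : ℕ → ℕ → Series
evens m d = geos (suc ∘ dbl) m d δ

odds : ℕ → ℕ → Series → Series
odds = geos dbl

-- The series of the partitions with smallest part 2(m + 1) resp. 2m + 1 when c = m; in general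
-- the odd parts 2j + 1 are replaced by 2(j + c - m) + 1. Even parts stop at 2(m + 1 + d) resp. 2(m + d).
A B : ℕ → ℕ → ℕ → Series
A c m d = mark (suc (dbl m)) (odds (suc c) (suc m) (evens (suc m) d))
B c m d = mark (dbl c) (odds (suc c) m (evens m d))

-- This is `exchange` for u = q^(2m+2) and v = q^(2c+3), with the common factors collected in `D`.
-- The odd parts in `D` run from 2c + 5 to 2(c + m + 1) + 1, so v is the odd part just below them
-- and uv the one just above.
AB-exchange : ∀ c m d →
  A c m d ⊕ B (suc c) (suc m) d ≗ A (suc c) m d ⊕ B (suc c) m (suc d)
AB-exchange c m d n = begin
  A c m d n xor B (suc c) (suc m) d n
    ≡⟨ cong (A c m d n xor_) (mark-cong b top n) ⟩
  mark a (geo b D) n xor mark b (geo (a + suc b) D) n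
    ≡⟨ exchange a b D n ⟩
  mark a (geo (a + suc b) D) n xor mark b (geo a D) n
    ≡⟨ cong₂ _xor_ (mark-cong a (λ k → sym (top k)) n)
         (mark-cong b (geo-geos a dbl (suc (suc c)) m (evens (suc m) d)) n) ⟩
  A (suc c) m d n xor B (suc c) m (suc d) n ∎
  where
  open ≡-Reasoning
  a = suc (dbl m)
  b = dbl (suc c)
  D = odds (suc (suc c)) m (evens (suc m) d)
  index : dbl (m + suc (suc c)) ≡ a + suc b
  index = begin
    dbl (m + suc (suc c))         ≡⟨ cong dbl (+-suc m (suc c)) ⟩
    suc (suc (dbl (m + suc c)))   ≡⟨ cong (suc ∘ suc) (dbl-+ m (suc c)) ⟩
    suc (suc (dbl m + b))         ≡⟨ cong suc (+-suc (dbl m) b) ⟨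
    a + suc b                     ∎
  top : odds (suc (suc c)) (suc m) (evens (suc m) d) ≗ geo (a + suc b) D
  top k = trans (geos-top dbl (suc (suc c)) m (evens (suc m) d) k) (cong (λ i → geo i D k) index)

-- The squared factor (1 - v)² is 1 - v² over 𝔽₂, an even power of q, so apart from the odd shift by
-- v everything has even support.
B-zero-half : ∀ c d → half (B c 0 d) ≗ 𝟘
B-zero-half c d n = trans
  (shift-cong (suc (dbl c)) (geo-geo (dbl c) (evens 0 d)) (dbl n))
  (half-shift-odd c _ (subst (λ k → EvenSupport (geo k (evens 0 d))) index
    (geo-evenSupport (dbl c) {evens 0 d} (geos-evenSupport 0 d {δ} (λ _ → refl)))) n)
  where
  index : suc (dbl (dbl c)) ≡ dbl c + suc (dbl c)
  index = trans (cong suc (dbl≡n+n (dbl c))) (sym (+-suc (dbl c) (dbl c)))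

∸-suc-suc : ∀ {m n} → m < n → n ∸ m ≡ suc (n ∸ suc m)
∸-suc-suc {zero}  {suc n} m<n       = refl
∸-suc-suc {suc m} {suc n} (s≤s m<n) = ∸-suc-suc m<n

-- For n ≤ M, the coefficient of q^(2n) in H^(r) with even parts cut off at 2M. The lengths `M ∸ m`
-- and `M ∸ suc m` give all terms this same cutoff, as telescoping requires.
H : ℕ → ℕ → ℕ → Bool
H M n r = ⨁ n (λ m → B (r + m) m (M ∸ m) (dbl n) xor A (r + m) m (M ∸ suc m) (dbl n))

H-suc : ∀ M n r → n ≤ M → H M n r ≡ H M n (suc r)
H-suc M n r n≤M = begin
  H M n r
    ≡⟨ ⨁-telescope n _ (λ m → B (r + m) m (M ∸ m) (dbl n))
         (λ m → B (suc r + m) m (M ∸ m) (dbl n) xor A (suc r + m) m (M ∸ suc m) (dbl n)) step ⟩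
  (B (r + 0) 0 M (dbl n) xor B (r + n) n (M ∸ n) (dbl n)) xor H M n (suc r)
    -- Both boundary terms vanish: at m = 0 only odd powers occur, and at m = n the marked part 2(r
    -- + n) + 1 exceeds 2n.
    ≡⟨ cong (_xor H M n (suc r)) (cong₂ _xor_ (B-zero-half (r + 0) M n)
         (mark-≤ _ _ (dbl-mono-≤ (m≤n+m n r)))) ⟩
  H M n (suc r) ∎
  where
  open ≡-Reasoning
  step : ∀ {m} → m < n →
    B (r + m) m (M ∸ m) (dbl n) xor A (r + m) m (M ∸ suc m) (dbl n) ≡
    (B (r + m) m (M ∸ m) (dbl n) xor B (r + suc m) (suc m) (M ∸ suc m) (dbl n))
      xor (B (suc r + m) m (M ∸ m) (dbl n) xor A (suc r + m) m (M ∸ suc m) (dbl n))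
  step {m} m<n
    -- Writing `M ∸ m` as `suc (M ∸ suc m)` matches the lengths `suc d` and `d` in `AB-exchange`.
    rewrite +-suc r m | ∸-suc-suc (<-≤-trans m<n n≤M) = begin
      b₀ xor a₀ ≡⟨ solve 3 (λ x y z → x :+ y := (x :+ z) :+ (y :+ z)) refl b₀ a₀ b₁ ⟩
      (b₀ xor b₁) xor (a₀ xor b₁)
        ≡⟨ cong ((b₀ xor b₁) xor_)
             (trans (AB-exchange (r + m) m d (dbl n)) (xor-comm (A (suc (r + m)) m d (dbl n)) _)) ⟩
      _ ∎
    where
    d = M ∸ suc m
    b₀ = B (r + m) m (suc d) (dbl n)
    a₀ = A (r + m) m d (dbl n)
    b₁ = B (suc (r + m)) (suc m) d (dbl n)

H-const : ∀ M n r → n ≤ M → H M n 0 ≡ H M n r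
H-const M n zero    n≤M = refl
H-const M n (suc r) n≤M = trans (H-const M n r n≤M) (H-suc M n r n≤M)

-- The limit of large r.

sptTerm : ℕ → ℕ → Series
sptTerm m d = geos id (suc m) d (mark m δ)

-- The odd parts are at least 2c + 3 > 2n and drop out; halving the remaining even parts gives
-- arbitrary parts.
A-limit : ∀ c m d n → n ≤ c → A c m d (dbl n) ≡ sptTerm m d n
A-limit c m d n n≤c = begin
  mark e (odds (suc c) (suc m) (evens (suc m) d)) (dbl n)
    ≡⟨ mark-geos e dbl (suc c) (suc m) (evens (suc m) d) (dbl n) ⟩
  odds (suc c) (suc m) (mark e (evens (suc m) d)) (dbl n)
    ≡⟨ geos-≤ dbl (suc c) (suc m) _ (λ i c<i → dbl-mono-≤ (≤-trans n≤c (<⇒≤ c<i))) ⟩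
  half (mark e (evens (suc m) d)) n
    ≡⟨ half-mark m (evens (suc m) d) n ⟩
  mark m (half (evens (suc m) d)) n
    ≡⟨ mark-cong m (λ k → trans (half-geos (suc m) d δ k) (geos-cong id (suc m) d half-δ k)) n ⟩
  mark m (geos id (suc m) d δ) n
    ≡⟨ mark-geos m id (suc m) d δ n ⟩
  sptTerm m d n ∎
  where
  open ≡-Reasoning
  e = suc (dbl m)

-- With r = n, each `B` term marks the part 2(n + m) + 1 > 2n and vanishes.
H-limit : ∀ M n → H M n n ≡ ⨁ n (λ m → sptTerm m (M ∸ suc m) n)
H-limit M n = ⨁-cong n (λ {m} _ → cong₂ _xor_
  (mark-≤ (dbl (n + m)) _ (dbl-mono-≤ (m≤m+n n m))) (A-limit (n + m) m (M ∸ suc m) n (m≤m+n n m)))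

-- Boolean comparisons, and sums over lists.

≡ᵇ-refl : ∀ n → (n ≡ᵇ n) ≡ true
≡ᵇ-refl zero    = refl
≡ᵇ-refl (suc n) = ≡ᵇ-refl n

≢⇒≡ᵇ-false : ∀ {m n} → m ≢ n → (m ≡ᵇ n) ≡ false
≢⇒≡ᵇ-false {zero}  {zero}  m≢n = contradiction refl m≢n
≢⇒≡ᵇ-false {zero}  {suc n} m≢n = refl
≢⇒≡ᵇ-false {suc m} {zero}  m≢n = refl
≢⇒≡ᵇ-false {suc m} {suc n} m≢n = ≢⇒≡ᵇ-false (m≢n ∘ cong suc)

≤⇒≤ᵇ-true : ∀ {m n} → m ≤ n → (m ≤ᵇ n) ≡ true
≤⇒≤ᵇ-true {zero}  _       = refl
≤⇒≤ᵇ-true {suc m} {suc n} (s≤s m≤n) with m | ≤⇒≤ᵇ-true m≤n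
... | zero  | _  = refl
... | suc _ | eq = eq

>⇒≤ᵇ-false : ∀ {m n} → n < m → (m ≤ᵇ n) ≡ false
>⇒≤ᵇ-false {suc zero}    {zero}  _         = refl
>⇒≤ᵇ-false {suc (suc m)} {zero}  _         = refl
>⇒≤ᵇ-false {suc zero}    {suc n} (s≤s ())
>⇒≤ᵇ-false {suc (suc m)} {suc n} (s≤s n<m) = >⇒≤ᵇ-false n<m

xsum : {A : Set} → (A → Bool) → List A → Bool
xsum f []       = false
xsum f (x ∷ xs) = f x xor xsum f xs

module _ {A : Set} where

  xsum-cong : ∀ {f g : A → Bool} xs → All (λ x → f x ≡ g x) xs → xsum f xs ≡ xsum g xs
  xsum-cong []       []         = refl
  xsum-cong (x ∷ xs) (eq ∷ eqs) = cong₂ _xor_ eq (xsum-cong xs eqs)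

  xsum-++ : ∀ (f : A → Bool) xs ys → xsum f (xs ++ ys) ≡ xsum f xs xor xsum f ys
  xsum-++ f []       ys = refl
  xsum-++ f (x ∷ xs) ys = trans (cong (f x xor_) (xsum-++ f xs ys)) (sym (xor-assoc (f x) _ _))

  xsum-xor : ∀ (f g : A → Bool) xs → xsum (λ x → f x xor g x) xs ≡ xsum f xs xor xsum g xs
  xsum-xor f g []       = refl
  xsum-xor f g (x ∷ xs) = trans (cong ((f x xor g x) xor_) (xsum-xor f g xs))
    (solve 4 (λ a b c d → (a :+ b) :+ (c :+ d) := (a :+ c) :+ (b :+ d)) refl (f x) (g x) (xsum f xs) (xsum g xs))

  xsum-∧ : ∀ c (f : A → Bool) xs → xsum (λ x → c ∧ f x) xs ≡ c ∧ xsum f xs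
  xsum-∧ c f []       = sym (∧-zeroʳ c)
  xsum-∧ c f (x ∷ xs) = trans (cong (c ∧ f x xor_) (xsum-∧ c f xs)) (sym (∧-distribˡ-xor c (f x) (xsum f xs)))

  xsum-⨁ : ∀ n (f : ℕ → A → Bool) xs → xsum (λ x → ⨁ n (λ i → f i x)) xs ≡ ⨁ n (λ i → xsum (f i) xs)
  xsum-⨁ zero    f []       = refl
  xsum-⨁ zero    f (x ∷ xs) = xsum-⨁ zero f xs
  xsum-⨁ (suc n) f xs       = trans (xsum-xor (λ x → ⨁ n (λ i → f i x)) (f n) xs)
    (cong (_xor xsum (f n) xs) (xsum-⨁ n f xs))

xsum-map : {A C : Set} (f : C → Bool) (g : A → C) (xs : List A) → xsum f (map g xs) ≡ xsum (f ∘ g) xs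
xsum-map f g []       = refl
xsum-map f g (x ∷ xs) = cong (f (g x) xor_) (xsum-map f g xs)

-- Partitions by largest part.

withLargest : ℕ → ℕ → ℕ → List (List ℕ)
withLargest fuel n p = if p ≤ᵇ suc n then map (p ∷_) (bpartsF fuel p (suc n ∸ p)) else []

bpartsF-fuel : ∀ {f g} k n → n ≤ f → n ≤ g → bpartsF f k n ≡ bpartsF g k n
bpartsF-fuel {f}     {g}     k zero    n≤f       n≤g       = refl
bpartsF-fuel {suc f} {suc g} k (suc n) (s≤s n≤f) (s≤s n≤g) = begin
  concatMap (withLargest f n) (map suc (upTo k))   ≡⟨ concatMap-map (withLargest f n) suc (upTo k) ⟩
  concatMap (withLargest f n ∘ suc) (upTo k)       ≡⟨ concatMap-cong same (upTo k) ⟩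
  concatMap (withLargest g n ∘ suc) (upTo k)       ≡⟨ concatMap-map (withLargest g n) suc (upTo k) ⟨
  concatMap (withLargest g n) (map suc (upTo k))   ∎
  where
  open ≡-Reasoning
  same : ∀ i → withLargest f n (suc i) ≡ withLargest g n (suc i)
  same i = cong (λ l → if suc i ≤ᵇ suc n then map (suc i ∷_) l else [])
    (bpartsF-fuel (suc i) (n ∸ i) (≤-trans (m∸n≤m n i) n≤f) (≤-trans (m∸n≤m n i) n≤g))

bpartsF-suc : ∀ f k n → bpartsF (suc f) (suc k) (suc n) ≡ bpartsF (suc f) k (suc n) ++ withLargest f n (suc k)
bpartsF-suc f k n = begin
  concatMap w (map suc (upTo (suc k)))             ≡⟨ cong (concatMap w ∘ map suc) (upTo-∷ʳ k) ⟨
  concatMap w (map suc (upTo k ∷ʳ k))              ≡⟨ cong (concatMap w) (map-++ suc (upTo k) (k ∷ [])) ⟩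
  concatMap w (map suc (upTo k) ++ suc k ∷ [])     ≡⟨ concatMap-++ w (map suc (upTo k)) (suc k ∷ []) ⟩
  concatMap w (map suc (upTo k)) ++ (w (suc k) ++ []) ≡⟨ cong (bpartsF (suc f) k (suc n) ++_) (++-identityʳ (w (suc k))) ⟩
  concatMap w (map suc (upTo k)) ++ w (suc k)      ∎
  where
  open ≡-Reasoning
  w = withLargest f n

T : ℕ → (List ℕ → Bool) → Series
T k ω n = xsum ω (bpartsF n k n)

T-cong : ∀ k {ω ω′} → ω ≗ ω′ → T k ω ≗ T k ω′
T-cong k ω≗ω′ n = xsum-cong (bpartsF n k n) (All.universal ω≗ω′ _)

-- Either no part equals k + 1, or one such part is removed from the front. This turns the
-- enumeration of lists into a recursion on series.
T-suc : ∀ k ω → T (suc k) ω ≗ T k ω ⊕ shift (suc k) (T (suc k) (ω ∘ (suc k ∷_)))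
T-suc k ω zero    = sym (xor-identityʳ _)
T-suc k ω (suc n) = begin
  xsum ω (bpartsF (suc n) (suc k) (suc n))
    ≡⟨ cong (xsum ω) (bpartsF-suc n k n) ⟩
  xsum ω (bpartsF (suc n) k (suc n) ++ withLargest n n (suc k))
    ≡⟨ xsum-++ ω (bpartsF (suc n) k (suc n)) (withLargest n n (suc k)) ⟩
  T k ω (suc n) xor xsum ω (withLargest n n (suc k))
    ≡⟨ cong (T k ω (suc n) xor_) (trans last (sym (shift-if (suc k) (T (suc k) (ω ∘ (suc k ∷_))) (suc n)))) ⟩
  T k ω (suc n) xor shift (suc k) (T (suc k) (ω ∘ (suc k ∷_))) (suc n) ∎
  where
  open ≡-Reasoning
  last : xsum ω (withLargest n n (suc k)) ≡
    (if suc k ≤ᵇ suc n then T (suc k) (ω ∘ (suc k ∷_)) (n ∸ k) else false)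
  last with suc k ≤ᵇ suc n
  ... | false = refl
  ... | true  = trans (xsum-map ω (suc k ∷_) (bpartsF n (suc k) (n ∸ k)))
    (cong (xsum (ω ∘ (suc k ∷_))) (bpartsF-fuel (suc k) (n ∸ k) (m∸n≤m n k) ≤-refl))

-- Parts above n cannot occur, so the bound may be moved to one of the shape that the closed forms
-- below need.
T-stable : ∀ {n k l} ω → n ≤ k → k ≤ l → T l ω n ≡ T k ω n
T-stable {n} {k} {l} ω n≤k k≤l = subst (λ i → T i ω n ≡ T k ω n) (m∸n+n≡m k≤l) (add (l ∸ k))
  where
  open ≡-Reasoning
  add : ∀ t → T (t + k) ω n ≡ T k ω n
  add zero    = refl
  add (suc t) = begin
    T (suc t + k) ω n       ≡⟨ T-suc (t + k) ω n ⟩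
    T (t + k) ω n xor shift (suc t + k) (T (suc t + k) (ω ∘ (suc t + k ∷_))) n
      ≡⟨ cong (T (t + k) ω n xor_) (shift-< {suc t + k} _ (s≤s (≤-trans n≤k (m≤n+m k t)))) ⟩
    T (t + k) ω n xor false ≡⟨ xor-identityʳ _ ⟩
    T (t + k) ω n           ≡⟨ add t ⟩
    T k ω n                 ∎

geoIf : Bool → ℕ → Series → Series
geoIf c p f = if c then geo p f else f

geoIf-cong : ∀ c p {f g} → f ≗ g → geoIf c p f ≗ geoIf c p g
geoIf-cong false p f≗g = f≗g
geoIf-cong true  p f≗g = geo-cong p f≗g

geoIf-𝟘 : ∀ c p → geoIf c p 𝟘 ≗ 𝟘
geoIf-𝟘 false p n = refl
geoIf-𝟘 true  p n = geo-𝟘 p n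

-- If the weight ignores a new part k + 1, `T-suc` is the defining equation of `geo k`; if it
-- forbids that part, the shifted term vanishes.
T-geoIf : ∀ c k ω → ω ∘ (suc k ∷_) ≗ (λ π → c ∧ ω π) → T (suc k) ω ≗ geoIf c k (T k ω)
T-geoIf true  k ω ω∷ = geo-unique k (T k ω) (λ n → trans (T-suc k ω n)
  (cong (T k ω n xor_) (shift-cong (suc k) (T-cong (suc k) ω∷) n)))
T-geoIf false k ω ω∷ n = begin
  T (suc k) ω n
    ≡⟨ T-suc k ω n ⟩
  T k ω n xor shift (suc k) (T (suc k) (ω ∘ (suc k ∷_))) n
    ≡⟨ cong (T k ω n xor_) (shift-cong (suc k)
         (λ j → trans (T-cong (suc k) ω∷ j) (xsum-∧ false ω (bpartsF j (suc k) j))) n) ⟩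
  T k ω n xor shift (suc k) 𝟘 n
    ≡⟨ cong (T k ω n xor_) (shift-𝟘 (suc k) n) ⟩
  T k ω n xor false
    ≡⟨ xor-identityʳ _ ⟩
  T k ω n ∎
  where open ≡-Reasoning

-- Partitions with a fixed smallest part.

null : List ℕ → Bool
null []      = true
null (_ ∷ _) = false

T-null : ∀ k → T k null ≗ δ
T-null zero    zero    = refl
T-null zero    (suc n) = refl
T-null (suc k) n = trans (T-suc k null n) (trans (cong₂ _xor_ (T-null k n)
  (trans (shift-cong (suc k) (λ j → xsum-∧ false null (bpartsF j (suc k) j)) n) (shift-𝟘 (suc k) n)))
  (xor-identityʳ _))

count : ℕ → List ℕ → ℕ
count s π = length (filter (_≟ s) π)

isOdd-suc : ∀ n → isOdd (suc n) ≡ not (isOdd n)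
isOdd-suc zero          = refl
isOdd-suc (suc zero)    = refl
isOdd-suc (suc (suc n)) = isOdd-suc n

-- `χ` is the indicator of smallest part s with all parts in Q; `ω` multiplies it by the
-- multiplicity of s modulo 2.
χ ω : (ℕ → Bool) → ℕ → List ℕ → Bool
χ Q s π = (smallest π ≡ᵇ s) ∧ all Q π
ω Q s π = χ Q s π ∧ isOdd (count s π)

module _ (Q : ℕ → Bool) (σ : ℕ) (Q-s : Q (suc σ) ≡ true) where

  private
    s = suc σ
    χₛ = χ Q s
    ωₛ = ω Q s

  χ-∷-≢ : ∀ {p} → p ≢ s → χₛ ∘ (p ∷_) ≗ (λ π → Q p ∧ χₛ π)
  χ-∷-≢ {p} p≢s []      = trans (cong (_∧ all Q (p ∷ [])) (≢⇒≡ᵇ-false p≢s)) (sym (∧-zeroʳ (Q p)))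
  χ-∷-≢ {p} p≢s (y ∷ π) = solve 3 (λ a b c → a :* (b :* c) := b :* (a :* c)) refl
    (smallest (y ∷ π) ≡ᵇ s) (Q p) (all Q (y ∷ π))

  ω-∷-≢ : ∀ {p} → p ≢ s → ωₛ ∘ (p ∷_) ≗ (λ π → Q p ∧ ωₛ π)
  ω-∷-≢ {p} p≢s π = trans
    (cong₂ (λ b xs → b ∧ isOdd (length xs)) (χ-∷-≢ p≢s π) (filter-reject (_≟ s) p≢s))
    (solve 3 (λ a b c → (a :* b) :* c := a :* (b :* c)) refl (Q p) (χₛ π) (isOdd (count s π)))

  χ-∷-≡ : χₛ ∘ (s ∷_) ≗ (λ π → null π xor χₛ π)
  χ-∷-≡ []      = cong₂ (λ a b → a ∧ (b ∧ true)) (≡ᵇ-refl s) Q-s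
  χ-∷-≡ (y ∷ π) = cong (λ b → (smallest (y ∷ π) ≡ᵇ s) ∧ (b ∧ all Q (y ∷ π))) Q-s

  -- The multiplicity grows by one, so the weight gains the indicator of `s ∷ π`. The term `null`
  -- accounts for the empty partition, which acquires smallest part s only now.
  ω-∷-≡ : ωₛ ∘ (s ∷_) ≗ (λ π → ωₛ π xor (null π xor χₛ π))
  ω-∷-≡ π = trans
    (cong₂ _∧_ (χ-∷-≡ π) (trans (cong (isOdd ∘ length) (filter-accept (_≟ s) {s} {π} refl)) (isOdd-suc (count s π))))
    (rearrange π)
    where
    rearrange : ∀ π → (null π xor χₛ π) ∧ not (isOdd (count s π)) ≡ ωₛ π xor (null π xor χₛ π)
    rearrange []      = refl
    rearrange (y ∷ π) with χₛ (y ∷ π)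
    ... | false = refl
    ... | true  = xor-comm true (isOdd (count s (y ∷ π)))

  -- Without a part s the weight reduces to its value at `[]`. A general `w` covers both `χₛ` and
  -- `ωₛ`.
  T-below : ∀ (w : List ℕ → Bool) → w [] ≡ false → (∀ {p} → p ≢ s → w ∘ (p ∷_) ≗ (λ π → Q p ∧ w π)) →
    ∀ k → k < s → T k w ≗ 𝟘
  T-below w w[] w∷ zero    k<s zero    = trans (xor-identityʳ _) w[]
  T-below w w[] w∷ zero    k<s (suc n) = refl
  T-below w w[] w∷ (suc k) k<s n = trans (T-geoIf (Q (suc k)) k w (w∷ (<⇒≢ k<s)) n)
    (trans (geoIf-cong (Q (suc k)) k (T-below w w[] w∷ k (<-trans (n<1+n k) k<s)) n) (geoIf-𝟘 (Q (suc k)) k n))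

  -- Only repetitions of s contribute; `δ` supplies the missing term 1 of the geometric series.
  T-χ : δ ⊕ T s χₛ ≗ geo σ δ
  T-χ = geo-unique σ δ (λ n → cong (δ n xor_) (begin
    T s χₛ n ≡⟨ T-suc σ χₛ n ⟩
    T σ χₛ n xor shift s (T s (χₛ ∘ (s ∷_))) n
      ≡⟨ cong₂ _xor_ (T-below χₛ refl χ-∷-≢ σ (n<1+n σ) n) (shift-cong s (λ j → trans (T-cong s χ-∷-≡ j)
          (trans (xsum-xor null χₛ (bpartsF j s j)) (cong (_xor T s χₛ j) (T-null s j)))) n) ⟩
    shift s (δ ⊕ T s χₛ) n ∎))
    where open ≡-Reasoning

  -- With u = q^s, the weight recursion reads w = u w + u/(1 - u), whence w = u/(1 - u)².
  T-base : T s ωₛ ≗ mark σ δ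
  T-base n = trans (geo-unique σ (shift s (geo σ δ)) eq n) (geo-shift σ s (geo σ δ) n)
    where
    open ≡-Reasoning
    eq : T s ωₛ ≗ shift s (geo σ δ) ⊕ shift s (T s ωₛ)
    eq k = begin
      T s ωₛ k
        ≡⟨ T-suc σ ωₛ k ⟩
      T σ ωₛ k xor shift s (T s (ωₛ ∘ (s ∷_))) k
        ≡⟨ cong₂ _xor_ (T-below ωₛ refl ω-∷-≢ σ (n<1+n σ) k) (shift-cong s (λ j → trans (T-cong s ω-∷-≡ j)
             (trans (xsum-xor ωₛ (λ π → null π xor χₛ π) (bpartsF j s j)) (cong (T s ωₛ j xor_)
               (trans (xsum-xor null χₛ (bpartsF j s j)) (trans (cong (_xor T s χₛ j) (T-null s j)) (T-χ j)))))) k) ⟩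
      shift s (T s ωₛ ⊕ geo σ δ) k
        ≡⟨ shift-⊕ s (T s ωₛ) (geo σ δ) k ⟩
      shift s (T s ωₛ) k xor shift s (geo σ δ) k
        ≡⟨ xor-comm (shift s (T s ωₛ) k) (shift s (geo σ δ) k) ⟩
      shift s (geo σ δ) k xor shift s (T s ωₛ) k ∎

  T-above : ∀ {k} → s ≤ k → T (suc k) ωₛ ≗ geoIf (Q (suc k)) k (T k ωₛ)
  T-above {k} s≤k = T-geoIf (Q (suc k)) k ωₛ (ω-∷-≢ (≢-sym (<⇒≢ (s≤s s≤k))))

  T-true : (∀ p → Q p ≡ true) → ∀ d → T (d + s) ωₛ ≗ geos id s d (mark σ δ)
  T-true Q≡true zero    = T-base
  T-true Q≡true (suc d) n = begin
    T (suc (d + s)) ωₛ n                       ≡⟨ T-above (m≤n+m s d) n ⟩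
    geoIf (Q (suc (d + s))) (d + s) (T (d + s) ωₛ) n
      ≡⟨ cong (λ c → geoIf c (d + s) (T (d + s) ωₛ) n) (Q≡true (suc (d + s))) ⟩
    geo (d + s) (T (d + s) ωₛ) n               ≡⟨ geo-cong (d + s) (T-true Q≡true d) n ⟩
    geo (d + s) (geos id s d base) n          ≡⟨ geos-top id s d base n ⟨
    geos id s (suc d) base n                  ∎
    where
    open ≡-Reasoning
    base = mark σ δ

-- The bound on odd parts, and identification with `A` and `B`.

geoIf-odds : ∀ c a l d f → (d < l → c ≡ true) → (l ≤ d → c ≡ false) →
  geoIf c (dbl (d + a)) (odds a (d ⊓ l) f) ≗ odds a (suc d ⊓ l) f
geoIf-odds c a l d f c-true c-false n with d <? l
... | yes d<l rewrite c-true d<l | m≤n⇒m⊓n≡m (<⇒≤ d<l) | m≤n⇒m⊓n≡m d<l = sym (geos-top dbl a d f n)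
... | no  d≮l rewrite c-false (≮⇒≥ d≮l) | m≥n⇒m⊓n≡n (≮⇒≥ d≮l) | m≥n⇒m⊓n≡n (m≤n⇒m≤1+n (≮⇒≥ d≮l)) = refl

isOdd-dbl : ∀ n → isOdd (dbl n) ≡ false
isOdd-dbl zero    = refl
isOdd-dbl (suc n) = isOdd-dbl n

isOdd-1+dbl : ∀ n → isOdd (suc (dbl n)) ≡ true
isOdd-1+dbl n = trans (isOdd-suc (dbl n)) (cong not (isOdd-dbl n))

allowed : ℕ → ℕ → Bool
allowed s x = if isOdd x then x ≤ᵇ 2 * s else true

allowed-smallest : ∀ s → allowed s s ≡ true
allowed-smallest s with isOdd s
... | true  = ≤⇒≤ᵇ-true (m≤m+n s (s + 0))
... | false = refl

allowed-even : ∀ s e → allowed s (dbl e) ≡ true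
allowed-even s e = cong (λ b → if b then dbl e ≤ᵇ 2 * s else true) (isOdd-dbl e)

allowed-odd : ∀ s e → allowed s (suc (dbl e)) ≡ (suc (dbl e) ≤ᵇ dbl s)
allowed-odd s e = trans (cong (λ b → if b then suc (dbl e) ≤ᵇ 2 * s else true) (isOdd-1+dbl e))
  (cong (suc (dbl e) ≤ᵇ_) (2*n≡dbl s))

allowed-odd-< : ∀ {s e} → e < s → allowed s (suc (dbl e)) ≡ true
allowed-odd-< {s} {e} e<s = trans (allowed-odd s e) (≤⇒≤ᵇ-true (≤-trans (n≤1+n _) (dbl-mono-≤ e<s)))

allowed-odd-≥ : ∀ {s e} → s ≤ e → allowed s (suc (dbl e)) ≡ false
allowed-odd-≥ {s} {e} s≤e = trans (allowed-odd s e) (>⇒≤ᵇ-false (s≤s (dbl-mono-≤ s≤e)))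

-- Each increment of `d` adjoins 2e + 1 and then 2e + 2, where e = d + m + 1. The odd one is allowed
-- when e < s = 2(m + 1), that is d < m + 1; hence the minimum.
T-allowed-even : ∀ m d → let s = dbl (suc m) in
  T (dbl (d + suc m)) (ω (allowed s) s) ≗
  odds (suc m) (d ⊓ suc m) (geos (suc ∘ dbl) (suc m) d (mark (suc (dbl m)) δ))
T-allowed-even m zero    = T-base (allowed (dbl (suc m))) (suc (dbl m)) (allowed-smallest (dbl (suc m)))
T-allowed-even m (suc d) n = begin
  T (suc (suc (dbl e))) w n
    ≡⟨ above (≤-trans s≤ (n≤1+n _)) n ⟩
  geoIf (Q (dbl (suc e))) (suc (dbl e)) (T (suc (dbl e)) w) n
    ≡⟨ cong (λ c → geoIf c (suc (dbl e)) (T (suc (dbl e)) w) n) (allowed-even s (suc e)) ⟩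
  geo (suc (dbl e)) (T (suc (dbl e)) w) n
    ≡⟨ geo-cong (suc (dbl e)) (λ k → trans (above s≤ k) (trans
         (geoIf-cong (Q (suc (dbl e))) (dbl e) (T-allowed-even m d) k)
         (geoIf-odds _ (suc m) (suc m) d E
           (λ d<m → allowed-odd-< {s} {e} (subst (e <_) (sym (dbl≡n+n (suc m))) (+-monoˡ-< (suc m) d<m)))
           (λ m≤d → allowed-odd-≥ {s} {e} (subst (_≤ e) (sym (dbl≡n+n (suc m))) (+-monoˡ-≤ (suc m) m≤d))) k))) n ⟩
  geo (suc (dbl e)) (odds (suc m) (suc d ⊓ suc m) E) n
    ≡⟨ geo-geos (suc (dbl e)) dbl (suc m) (suc d ⊓ suc m) E n ⟩
  odds (suc m) (suc d ⊓ suc m) (geo (suc (dbl e)) E) n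
    ≡⟨ geos-cong dbl (suc m) (suc d ⊓ suc m) (λ k → sym (geos-top (suc ∘ dbl) (suc m) d base k)) n ⟩
  odds (suc m) (suc d ⊓ suc m) (geos (suc ∘ dbl) (suc m) (suc d) base) n ∎
  where
  open ≡-Reasoning
  s = dbl (suc m)
  e = d + suc m
  Q = allowed s
  w = ω Q s
  base = mark (suc (dbl m)) δ
  E = geos (suc ∘ dbl) (suc m) d base
  s≤ : s ≤ dbl e
  s≤ = dbl-mono-≤ (m≤n+m (suc m) d)
  above = λ {k} → T-above Q (suc (dbl m)) (allowed-smallest s) {k}

-- Here the even part 2e + 2 comes first, then 2e + 3 with e = d + m, allowed when e + 1 < s = 2m +
-- 1, that is d < m.
T-allowed-odd : ∀ m d → let s = suc (dbl m) in
  T (suc (dbl (d + m))) (ω (allowed s) s) ≗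
  odds (suc m) (d ⊓ m) (geos (suc ∘ dbl) m d (mark (dbl m) δ))
T-allowed-odd m zero    = T-base (allowed (suc (dbl m))) (dbl m) (allowed-smallest (suc (dbl m)))
T-allowed-odd m (suc d) n = begin
  T (suc (dbl (suc e))) w n
    ≡⟨ above (≤-trans s≤ (n≤1+n _)) n ⟩
  geoIf (Q (suc (dbl (suc e)))) (dbl (suc e)) (T (dbl (suc e)) w) n
    ≡⟨ geoIf-cong (Q (suc (dbl (suc e)))) (dbl (suc e)) even n ⟩
  geoIf (Q (suc (dbl (suc e)))) (dbl (suc e)) (odds (suc m) (d ⊓ m) (geos (suc ∘ dbl) m (suc d) base)) n
    ≡⟨ cong (λ i → geoIf (Q (suc (dbl (suc e)))) (dbl i) (odds (suc m) (d ⊓ m) (geos (suc ∘ dbl) m (suc d) base)) n)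
         (+-suc d m) ⟨
  geoIf (Q (suc (dbl (suc e)))) (dbl (d + suc m)) (odds (suc m) (d ⊓ m) (geos (suc ∘ dbl) m (suc d) base)) n
    ≡⟨ geoIf-odds _ (suc m) m d (geos (suc ∘ dbl) m (suc d) base)
         (λ d<m → allowed-odd-< {s} {suc e} (s≤s (subst (e <_) (sym (dbl≡n+n m)) (+-monoˡ-< m d<m))))
         (λ m≤d → allowed-odd-≥ {s} {suc e} (s≤s (subst (_≤ e) (sym (dbl≡n+n m)) (+-monoˡ-≤ m m≤d)))) n ⟩
  odds (suc m) (suc d ⊓ m) (geos (suc ∘ dbl) m (suc d) base) n ∎
  where
  open ≡-Reasoning
  s = suc (dbl m)
  e = d + m
  Q = allowed s
  w = ω Q s
  base = mark (dbl m) δ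
  s≤ : s ≤ suc (dbl e)
  s≤ = s≤s (dbl-mono-≤ (m≤n+m m d))
  above = λ {k} → T-above Q (dbl m) (allowed-smallest s) {k}
  even : T (dbl (suc e)) w ≗ odds (suc m) (d ⊓ m) (geos (suc ∘ dbl) m (suc d) base)
  even k = begin
    T (suc (suc (dbl e))) w k
      ≡⟨ above s≤ k ⟩
    geoIf (Q (dbl (suc e))) (suc (dbl e)) (T (suc (dbl e)) w) k
      ≡⟨ cong (λ c → geoIf c (suc (dbl e)) (T (suc (dbl e)) w) k) (allowed-even s (suc e)) ⟩
    geo (suc (dbl e)) (T (suc (dbl e)) w) k
      ≡⟨ geo-cong (suc (dbl e)) (T-allowed-odd m d) k ⟩
    geo (suc (dbl e)) (odds (suc m) (d ⊓ m) (geos (suc ∘ dbl) m d base)) k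
      ≡⟨ geo-geos (suc (dbl e)) dbl (suc m) (d ⊓ m) _ k ⟩
    odds (suc m) (d ⊓ m) (geo (suc (dbl e)) (geos (suc ∘ dbl) m d base)) k
      ≡⟨ geos-cong dbl (suc m) (d ⊓ m) (λ j → sym (geos-top (suc ∘ dbl) m d base j)) k ⟩
    odds (suc m) (d ⊓ m) (geos (suc ∘ dbl) m (suc d) base) k ∎

T-A : ∀ m d → suc m ≤ d → let s = dbl (suc m) in T (dbl (d + suc m)) (ω (allowed s) s) ≗ A m m d
T-A m d m<d n = begin
  T (dbl (d + suc m)) (ω (allowed s) s) n                  ≡⟨ T-allowed-even m d n ⟩
  odds (suc m) (d ⊓ suc m) (geos (suc ∘ dbl) (suc m) d (mark p δ)) n
    ≡⟨ cong (λ l → odds (suc m) l (geos (suc ∘ dbl) (suc m) d (mark p δ)) n) (m≥n⇒m⊓n≡n m<d) ⟩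
  odds (suc m) (suc m) (geos (suc ∘ dbl) (suc m) d (mark p δ)) n
    ≡⟨ geos-cong dbl (suc m) (suc m) (λ k → sym (mark-geos p (suc ∘ dbl) (suc m) d δ k)) n ⟩
  odds (suc m) (suc m) (mark p (evens (suc m) d)) n
    ≡⟨ mark-geos p dbl (suc m) (suc m) (evens (suc m) d) n ⟨
  A m m d n ∎
  where
  open ≡-Reasoning
  s = dbl (suc m)
  p = suc (dbl m)

T-B : ∀ m d → m ≤ d → let s = suc (dbl m) in T (suc (dbl (d + m))) (ω (allowed s) s) ≗ B m m d
T-B m d m≤d n = begin
  T (suc (dbl (d + m))) (ω (allowed s) s) n                ≡⟨ T-allowed-odd m d n ⟩
  odds (suc m) (d ⊓ m) (geos (suc ∘ dbl) m d (mark p δ)) n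
    ≡⟨ cong (λ l → odds (suc m) l (geos (suc ∘ dbl) m d (mark p δ)) n) (m≥n⇒m⊓n≡n m≤d) ⟩
  odds (suc m) m (geos (suc ∘ dbl) m d (mark p δ)) n
    ≡⟨ geos-cong dbl (suc m) m (λ k → sym (mark-geos p (suc ∘ dbl) m d δ k)) n ⟩
  odds (suc m) m (mark p (evens m d)) n
    ≡⟨ mark-geos p dbl (suc m) m (evens m d) n ⟨
  B m m d n ∎
  where
  open ≡-Reasoning
  s = suc (dbl m)
  p = dbl m

-- Splitting the sum by smallest part.

SmallestWithin : ℕ → List ℕ → Set
SmallestWithin k []      = ⊤
SmallestWithin k (x ∷ π) = 0 < smallest (x ∷ π) × smallest (x ∷ π) ≤ k

bpartsF-smallest : ∀ f k n → All (SmallestWithin k) (bpartsF f k n)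
bpartsF-smallest f       k zero    = tt ∷ []
bpartsF-smallest zero    k (suc n) = []
bpartsF-smallest (suc f) k (suc n) =
  All.concat⁺ (All.map⁺ (All.map⁺ (All.applyUpTo⁺₁ id k withLargest-smallest)))
  where
  cons : ∀ {i π} → i < k → SmallestWithin (suc i) π → SmallestWithin k (suc i ∷ π)
  cons {π = []}    i<k _           = s≤s z≤n , i<k
  cons {π = _ ∷ _} i<k (0<s , s≤i) = 0<s , ≤-trans s≤i i<k
  withLargest-smallest : ∀ {i} → i < k → All (SmallestWithin k) (withLargest f n (suc i))
  withLargest-smallest {i} i<k with suc i ≤ᵇ suc n
  ... | false = []
  ... | true  = All.map⁺ (All.map (λ {π} → cons {π = π} i<k) (bpartsF-smallest f (suc i) (n ∸ i)))

⨁-𝟘 : ∀ n → ⨁ n (λ _ → false) ≡ false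
⨁-𝟘 zero    = refl
⨁-𝟘 (suc n) = trans (xor-identityʳ _) (⨁-𝟘 n)

⨁-pick : ∀ {n j} (g : ℕ → Bool) → j < n → ⨁ n (λ i → (j ≡ᵇ i) ∧ g i) ≡ g j
⨁-pick {suc n} {j} g (s≤s j≤n) with j ≟ n
... | yes refl rewrite ≡ᵇ-refl j = cong (_xor g j) (trans
        (⨁-cong j (λ {i} i<j → cong (_∧ g i) (≢⇒≡ᵇ-false (≢-sym (<⇒≢ i<j))))) (⨁-𝟘 j))
... | no  j≢n  rewrite ≢⇒≡ᵇ-false j≢n = trans (xor-identityʳ _) (⨁-pick g (≤∧≢⇒< j≤n j≢n))

weight : (ℕ → ℕ → Bool) → List ℕ → Bool
weight P π = all (P (smallest π)) π ∧ isOdd (occSmallest π)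

-- A nonempty partition meets exactly one index, its smallest part less one; the empty partition has
-- weight zero on both sides.
weight-⨁ : ∀ P N π → SmallestWithin N π → weight P π ≡ ⨁ N (λ i → ω (P (suc i)) (suc i) π)
weight-⨁ P N []      _           = sym (⨁-𝟘 N)
weight-⨁ P N (x ∷ π) (0<s , s≤N) with smallest (x ∷ π)
... | suc j = sym (trans
  (⨁-cong N (λ {i} _ → Bool.∧-assoc (j ≡ᵇ i) (all (P (suc i)) (x ∷ π)) (isOdd (count (suc i) (x ∷ π)))))
  (⨁-pick (λ i → all (P (suc i)) (x ∷ π) ∧ isOdd (count (suc i) (x ∷ π))) s≤N))

xsum-weight : ∀ P N → xsum (weight P) (partitions N) ≡ ⨁ N (λ i → T N (ω (P (suc i)) (suc i)) N)
xsum-weight P N = trans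
  (xsum-cong (partitions N) (All.map (λ {π} → weight-⨁ P N π) (bpartsF-smallest N N N)))
  (xsum-⨁ N (λ i → ω (P (suc i)) (suc i)) (partitions N))

-- Parity of the two counting functions.

isOdd-+ : ∀ m n → isOdd (m + n) ≡ isOdd m xor isOdd n
isOdd-+ zero          n = refl
isOdd-+ (suc zero)    n = isOdd-suc n
isOdd-+ (suc (suc m)) n = isOdd-+ m n

isOdd-sum : {X : Set} (b : X → Bool) (f : X → ℕ) (xs : List X) →
  isOdd (sum (map f (filter (λ x → b x Bool.≟ true) xs))) ≡ xsum (λ x → b x ∧ isOdd (f x)) xs
isOdd-sum b f []       = refl
isOdd-sum b f (x ∷ xs) with b x
... | true  = trans (isOdd-+ (f x) _) (cong (isOdd (f x) xor_) (isOdd-sum b f xs))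
... | false = isOdd-sum b f xs

-- Identifies a function by its recursion equations alone, so that it applies to the local function
-- inside `oddCondition`.
all-unique : ∀ Q (g : List ℕ → Bool) → g [] ≡ true → (∀ x xs → g (x ∷ xs) ≡ Q x ∧ g xs) → g ≗ all Q
all-unique Q g g[] g∷ []       = g[]
all-unique Q g g[] g∷ (x ∷ xs) = trans (g∷ x xs) (cong (Q x ∧_) (all-unique Q g g[] g∷ xs))

-- The recursion local to oddCondition cannot be named; it is found by unification, once
-- x ∷ π has been abstracted so that its two arguments are distinct variables.
mutual
  oddCondition-go : List ℕ → List ℕ → Bool
  oddCondition-go = _

  oddCondition-all : ∀ π → oddCondition π ≡ all (allowed (smallest π)) π
  oddCondition-all []      = refl
  oddCondition-all (x ∷ π) with x ∷ π
  ... | w = cong (allowed (smallest w) x ∧_)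
    (all-unique (allowed (smallest w)) (oddCondition-go w) refl (λ _ _ → refl) π)

isOdd-sptoPlus : ∀ N → isOdd (sptoPlus N) ≡ ⨁ N (λ i → T N (ω (allowed (suc i)) (suc i)) N)
isOdd-sptoPlus N = begin
  isOdd (sptoPlus N)
    ≡⟨ isOdd-sum oddCondition occSmallest (partitions N) ⟩
  xsum (λ π → oddCondition π ∧ isOdd (occSmallest π)) (partitions N)
    ≡⟨ xsum-cong (partitions N) (All.universal (λ π → cong (_∧ isOdd (occSmallest π)) (oddCondition-all π)) _) ⟩
  xsum (weight allowed) (partitions N)
    ≡⟨ xsum-weight allowed N ⟩
  ⨁ N (λ i → T N (ω (allowed (suc i)) (suc i)) N) ∎
  where open ≡-Reasoning

all-true : ∀ (π : List ℕ) → all (λ _ → true) π ≡ true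
all-true []      = refl
all-true (_ ∷ π) = all-true π

isOdd-spt : ∀ N → isOdd (spt N) ≡ ⨁ N (λ i → T N (ω (λ _ → true) (suc i)) N)
isOdd-spt N = begin
  isOdd (sum (map occSmallest (partitions N)))
    -- A filter that keeps everything brings the sum into the shape of `isOdd-sum`.
    ≡⟨ cong (isOdd ∘ sum ∘ map occSmallest) (filter-all (λ _ → true Bool.≟ true) (All.universal (λ _ → refl) (partitions N))) ⟨
  isOdd (sum (map occSmallest (filter (λ _ → true Bool.≟ true) (partitions N))))
    ≡⟨ isOdd-sum (λ _ → true) occSmallest (partitions N) ⟩
  xsum (isOdd ∘ occSmallest) (partitions N)
    ≡⟨ xsum-cong (partitions N) (All.universal (λ π → cong (_∧ isOdd (occSmallest π)) (sym (all-true π))) _) ⟩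
  xsum (weight (λ _ _ → true)) (partitions N)
    ≡⟨ xsum-weight (λ _ _ → true) N ⟩
  ⨁ N (λ i → T N (ω (λ _ → true) (suc i)) N) ∎
  where open ≡-Reasoning

-- Assembling the congruence.

isOdd-sptoPlus-H : ∀ n → isOdd (sptoPlus (2 * n)) ≡ H (n + n) n 0
isOdd-sptoPlus-H n = begin
  isOdd (sptoPlus (2 * n))                      ≡⟨ cong (isOdd ∘ sptoPlus) (2*n≡dbl n) ⟩
  isOdd (sptoPlus N)                            ≡⟨ isOdd-sptoPlus N ⟩
  -- Index i stands for smallest part i + 1, so i = 2m leads to `B` and i = 2m + 1 to `A`.
  ⨁ N (λ i → T N (ω (allowed (suc i)) (suc i)) N) ≡⟨ ⨁-dbl n _ ⟩
  ⨁ n (λ m → T N (ω (allowed (suc (dbl m))) (suc (dbl m))) N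
             xor T N (ω (allowed (dbl (suc m))) (dbl (suc m))) N)
    ≡⟨ ⨁-cong n (λ m<n → cong₂ _xor_ (to-B m<n) (to-A m<n)) ⟩
  H M n 0                                       ∎
  where
  open ≡-Reasoning
  N = dbl n
  -- For m < n this ensures m ≤ M - m and m + 1 ≤ M - (m + 1), so that `T-B` and `T-A` apply with
  -- all allowed odd parts present.
  M = n + n
  to-B : ∀ {m} → m < n → T N (ω (allowed (suc (dbl m))) (suc (dbl m))) N ≡ B m m (M ∸ m) N
  to-B {m} m<n = trans
    (sym (T-stable (ω (allowed (suc (dbl m))) (suc (dbl m))) ≤-refl
      (m≤n⇒m≤1+n (dbl-mono-≤ (subst (n ≤_) (sym (m∸n+n≡m m≤M)) (m≤m+n n n))))))
    (T-B m (M ∸ m) (m+n≤o⇒m≤o∸n m (+-mono-≤ (<⇒≤ m<n) (<⇒≤ m<n))) N)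
    where m≤M = ≤-trans (<⇒≤ m<n) (m≤m+n n n)
  to-A : ∀ {m} → m < n → T N (ω (allowed (dbl (suc m))) (dbl (suc m))) N ≡ A m m (M ∸ suc m) N
  to-A {m} m<n = trans
    (sym (T-stable (ω (allowed (dbl (suc m))) (dbl (suc m))) ≤-refl
      (dbl-mono-≤ (subst (n ≤_) (sym (m∸n+n≡m m<M)) (m≤m+n n n)))))
    (T-A m (M ∸ suc m) (m+n≤o⇒m≤o∸n (suc m) (+-mono-≤ m<n m<n)) N)
    where m<M = ≤-trans m<n (m≤m+n n n)

isOdd-spt-terms : ∀ M n → n ≤ M → isOdd (spt n) ≡ ⨁ n (λ m → sptTerm m (M ∸ suc m) n)
isOdd-spt-terms M n n≤M = trans (isOdd-spt n) (⨁-cong n term)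
  where
  term : ∀ {m} → m < n → T n (ω (λ _ → true) (suc m)) n ≡ sptTerm m (M ∸ suc m) n
  term {m} m<n = trans
    (sym (T-stable (ω (λ _ → true) (suc m)) ≤-refl
      (subst (n ≤_) (sym (m∸n+n≡m (≤-trans m<n n≤M))) n≤M)))
    (T-true (λ _ → true) m refl (λ _ → refl) (M ∸ suc m) n)

%2-isOdd : ∀ n → n % 2 ≡ (if isOdd n then 1 else 0)
%2-isOdd zero          = refl
%2-isOdd (suc zero)    = refl
%2-isOdd (suc (suc n)) = %2-isOdd n

theorem3 : (n : ℕ) → n ≥ 1 → sptoPlus (2 * n) % 2 ≡ spt n % 2
theorem3 n _ = begin
  sptoPlus (2 * n) % 2                           ≡⟨ %2-isOdd (sptoPlus (2 * n)) ⟩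
  (if isOdd (sptoPlus (2 * n)) then 1 else 0)    ≡⟨ cong (if_then 1 else 0) same-parity ⟩
  (if isOdd (spt n) then 1 else 0)               ≡⟨ %2-isOdd (spt n) ⟨
  spt n % 2                                      ∎
  where
  open ≡-Reasoning
  same-parity : isOdd (sptoPlus (2 * n)) ≡ isOdd (spt n)
  same-parity = begin
    isOdd (sptoPlus (2 * n))                     ≡⟨ isOdd-sptoPlus-H n ⟩
    -- The value r = n already pushes all odd parts beyond 2n.
    H (n + n) n 0                                ≡⟨ H-const (n + n) n n (m≤m+n n n) ⟩
    H (n + n) n n                                ≡⟨ H-limit (n + n) n ⟩
    ⨁ n (λ m → sptTerm m (n + n ∸ suc m) n)      ≡⟨ isOdd-spt-terms (n + n) n (m≤m+n n n) ⟨
    isOdd (spt n)                                ∎
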